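{- Let $n\ge 2$ and let $D=(D_1,\dots,D_{n-1})$ be a tuple of positive integers. For $M,N\in\mathbb{Z}^{n-1}$, the value of the long Weyl element Kloosterman sum $S_n(M,N;D)$ depends only on the congruence classes of $M_i$ and $N_i$ in $\mathbb{Z}/D_i\mathbb{Z}$, $i=1,\dots,n-1$; that is, if $M,M',N,N'\in\mathbb{Z}^{n-1}$ satisfy $M_i\equiv M'_i$ and $N_i\equiv N'_i\pmod{D_i}$ for all $1\le i\le n-1$, then $S_n(M,N;D)=S_n(M',N';D)$.
   Context: Definition of $S_n(M,N;D)$: $e(z)=e^{2\pi i z}$. $U$ is the group of upper triangular unipotent $n\times n$ matrices. For $N\in\mathbb{Z}^{n-1}$, $\psi_N$ is the character of $U(\mathbb{R})$, trivial on $U(\mathbb{Z})$, given by $\psi_N(u)=e(N_1u_{1,2}+N_2u_{2,3}+\cdots+N_{n-1}u_{n-1,n})$. For $M\in \mathbb{Z}^{n-1}$, $\tilde M=(M_{n-1},\dots,M_1)$. Let $w_0$ be the long Weyl element: the $n\times n$ matrix whose only nonzero entries are on the anti-diagonal, the entry at position $(n-k+1,k)$ being $(-1)^{k-1}$ ($1\le k\le n$). Let $c=\mathrm{Diag}(1/D_{n-1},\,D_{n-1}/D_{n-2},\dots,D_2/D_1,\,D_1)$, $C(c)=U(\mathbb{R})\,c\,w_0\,U(\mathbb{R})\cap SL(n,\mathbb{Z})$ and $X(c)=U(\mathbb{Z})\backslash C(c)/U(\mathbb{Z})$. Each $\gamma\in C(c)$ is uniquely $\gamma=b_1cw_0b_2$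 with $b_1,b_2\in U(\mathbb{R})$; set $\mu(\gamma)=b_1\in U(\mathbb{Z})\backslash U(\mathbb{R})$ and $\mu'(\gamma)=b_2\in U(\mathbb{R})/U(\mathbb{Z})$. Then $$S_n(M,N;D)=\sum_{x\in X(c)}\psi_{\tilde M}(\mu(x))\,\psi_N(\mu'(x)).$$ -}

module Defs where

open import Level using (Level; _⊔_) renaming (suc to lsuc)
open import Algebra.Bundles.Raw using (RawRing)
open import Algebra.Structures using (IsCommutativeRing)
import Algebra.Definitions.RawSemiring as RawSemiringDefinitions
open import Data.Bool.Base using (if_then_else_)
open import Data.Fin.Base as Fin
  using (Fin; zero; suc; toℕ; fromℕ; inject₁; opposite; punchIn)
import Data.Fin.Properties as Fin
open import Data.Integer.Base as ℤ using (ℤ; +_; -[1+_])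
open import Data.Nat.Base as ℕ using (ℕ; zero; suc; NonZero)
open import Data.Product.Base using (Σ; ∃; ∃₂; _×_; _,_; proj₁; proj₂)
open import Data.Product.Relation.Binary.Pointwise.NonDependent using (Pointwise)
open import Data.Sum.Base using (_⊎_)
open import Data.Vec.Functional using (Vector; _∷_; insertAt; reverse)
open import Function.Definitions using (Injective; StrictlySurjective)
open import Relation.Binary.Core using (Rel)
open import Relation.Binary.PropositionalEquality.Core using (_≡_)
open import Relation.Binary.Structures using (IsStrictPartialOrder)
open import Relation.Nullary using (¬_)
open import Relation.Nullary.Decidable using (⌊_⌋)

ℕ⁺ : Set
ℕ⁺ = Σ ℕ NonZero

1⁺ : ℕ⁺
1⁺ = 1 , _

------------------------------------------------------------------------
-- Real numbers

-- The library has no real numbers, so they are specified as a complete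
-- Archimedean ordered field.  The axioms are the constructive ones (< is
-- cotransitive and tight instead of trichotomous, Cauchy sequences carry
-- a modulus), so that both Cauchy reals and classical reals are models.

record Reals (c ℓ₁ ℓ₂ : Level) : Set (lsuc (c ⊔ ℓ₁ ⊔ ℓ₂)) where
  infix  8 -_
  infixl 7 _*_
  infixl 6 _+_
  infix  4 _≈_ _<_
  field
    Carrier              : Set c
    _≈_                  : Rel Carrier ℓ₁
    _<_                  : Rel Carrier ℓ₂
    _+_ _*_              : Carrier → Carrier → Carrier
    -_                   : Carrier → Carrier
    0# 1#                : Carrier
    isCommutativeRing    : IsCommutativeRing _≈_ _+_ _*_ -_ 0# 1#
    isStrictPartialOrder : IsStrictPartialOrder _≈_ _<_

  rawRing : RawRing c ℓ₁
  rawRing = record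
    { _≈_ = _≈_ ; _+_ = _+_ ; _*_ = _*_ ; -_ = -_ ; 0# = 0# ; 1# = 1# }

  open RawSemiringDefinitions (RawRing.rawSemiring rawRing) public
    using () renaming (_×_ to _·ℕ_)

  fromNat : ℕ → Carrier
  fromNat k = k ·ℕ 1#

  Cauchy : (ℕ → Carrier) → Set ℓ₂
  Cauchy f = ∀ k → ∃ λ K → ∀ i j → K ℕ.≤ i → K ℕ.≤ j →
             fromNat (suc k) * (f i + - f j) < 1#

  _⟶_ : (ℕ → Carrier) → Carrier → Set ℓ₂
  f ⟶ x = ∀ k → ∃ λ K → ∀ i → K ℕ.≤ i →
          (fromNat (suc k) * (f i + - x) < 1#) ×
          (fromNat (suc k) * (x + - f i) < 1#)

  field
    <-cotransitive : ∀ {x y} → x < y → ∀ z → (x < z) ⊎ (z < y)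
    <-tight        : ∀ {x y} → ¬ (x < y) → ¬ (y < x) → x ≈ y
    0<1            : 0# < 1#
    +-monoˡ-<      : ∀ z {x y} → x < y → x + z < y + z
    *-positive     : ∀ {x y} → 0# < x → 0# < y → 0# < x * y
    reciprocal     : ∀ {x} → 0# < x → ∃ λ y → x * y ≈ 1#
    archimedean    : ∀ x → ∃ λ k → x < fromNat k
    complete       : ∀ f → Cauchy f → ∃ λ x → f ⟶ x

  open IsCommutativeRing isCommutativeRing public
    using (+-identityˡ)
  open IsStrictPartialOrder isStrictPartialOrder public
    using (<-respˡ-≈; <-respʳ-≈) renaming (trans to <-trans)

  fromℤ : ℤ → Carrier
  fromℤ (+ k)    = fromNat k
  fromℤ -[1+ k ] = - fromNat (suc k)

  0<fromNat : ∀ k → 0# < fromNat (suc k)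
  0<fromNat zero    = <-respʳ-≈ (IsCommutativeRing.sym isCommutativeRing
                       (IsCommutativeRing.+-identityʳ isCommutativeRing 1#)) 0<1
  0<fromNat (suc k) = <-trans (0<fromNat k)
                       (<-respˡ-≈ (+-identityˡ _) (+-monoˡ-< (fromNat (suc k)) 0<1))

  fraction : ℕ⁺ → ℕ⁺ → Carrier
  fraction (a , _) (suc b , _) = fromNat a * proj₁ (reciprocal (0<fromNat b))

------------------------------------------------------------------------
-- Complex numbers and e(x) = exp(2πix)

complexes : ∀ {c ℓ₁ ℓ₂} → Reals c ℓ₁ ℓ₂ → RawRing c ℓ₁
complexes R = record
  { Carrier = Carrier × Carrier
  ; _≈_     = Pointwise _≈_ _≈_
  ; _+_     = λ (a , b) (a′ , b′) → (a + a′ , b + b′)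
  ; _*_     = λ (a , b) (a′ , b′) → (a * a′ + - (b * b′) , a * b′ + b * a′)
  ; -_      = λ (a , b) → (- a , - b)
  ; 0#      = 0# , 0#
  ; 1#      = 1# , 0#
  }
  where open Reals R

-- These axioms have x ↦ exp(2πix) as their only solution.  Indeed
-- e(1/2) = ±1, and e(1/2) = 1 would give e(1/4) = ±1, contradicting
-- Im e(1/4) > 0; so e(1/2) = -1 and e(1/4) = i.  Repeatedly taking the
-- square root in the upper half plane determines e at dyadic rationals,
-- and positivity of Im e on (0 , 1/2) makes the argument of e monotone
-- there, which determines e everywhere.

record Exponential {c ℓ₁ ℓ₂} (R : Reals c ℓ₁ ℓ₂) : Set (c ⊔ ℓ₁ ⊔ ℓ₂) where
  open Reals R
  private module ℂ = RawRing (complexes R)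
  field
    e          : Carrier → ℂ.Carrier
    e-cong     : ∀ {x y} → x ≈ y → e x ℂ.≈ e y
    e-+        : ∀ x y → e (x + y) ℂ.≈ e x ℂ.* e y
    e-1        : e 1# ℂ.≈ ℂ.1#
    e-modulus  : ∀ x → proj₁ (e x) * proj₁ (e x) + proj₂ (e x) * proj₂ (e x) ≈ 1#
    e-upper    : ∀ {x} → 0# < x → x + x < 1# → 0# < proj₂ (e x)

------------------------------------------------------------------------
-- Matrices

module Matrices {c ℓ} (A : RawRing c ℓ) where
  open RawRing A
  open RawSemiringDefinitions rawSemiring public using (sum; _^_)

  Matrix : ℕ → Set c
  Matrix n = Fin n → Fin n → Carrier

  infix 4 _≋_
  _≋_ : ∀ {n} → Rel (Matrix n) ℓ
  P ≋ Q = ∀ i j → P i j ≈ Q i j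

  infixl 7 _·_
  _·_ : ∀ {n} → Matrix n → Matrix n → Matrix n
  (P · Q) i j = sum λ k → P i k * Q k j

  diagonal : ∀ {n} → Vector Carrier n → Matrix n
  diagonal d i j = if ⌊ i Fin.≟ j ⌋ then d i else 0#

  det : ∀ {n} → Matrix n → Carrier
  det {zero}  P = 1#
  det {suc n} P = sum λ j →
    (- 1#) ^ toℕ j * P zero j * det (λ i k → P (suc i) (punchIn j k))

  UpperUnipotent : ∀ {n} → Matrix n → Set ℓ
  UpperUnipotent u = (∀ i → u i i ≈ 1#) × (∀ i j → j Fin.< i → u i j ≈ 0#)

  -- Counting from 0, column j has its only nonzero entry in row n - 1 - j.
  longWeyl : ∀ {n} → Matrix n
  longWeyl i j = if ⌊ i Fin.≟ opposite j ⌋ then (- 1#) ^ toℕ j else 0#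

module Mℤ = Matrices ℤ.+-*-rawRing

------------------------------------------------------------------------
-- Kloosterman sums; the matrices have size n = suc m

module _ {c ℓ₁ ℓ₂} (R : Reals c ℓ₁ ℓ₂) where
  open Reals R
  private
    module Mℝ = Matrices rawRing
    module ℂ  = RawRing (complexes R)

  -- With D₀ = Dₙ = 1, the k-th diagonal entry (1 ≤ k ≤ n) of c is
  -- D₍ₙ₋ₖ₊₁₎ / D₍ₙ₋ₖ₎.  The numerators are read off from (D₁,…,Dₙ₋₁,1)
  -- and the denominators from (1,D₁,…,Dₙ₋₁), both backwards.
  torusElement : ∀ {m} → Vector ℕ⁺ m → Mℝ.Matrix (suc m)
  torusElement {m} D = Mℝ.diagonal λ i →
    fraction (reverse (insertAt D (fromℕ m) 1⁺) i) (reverse (1⁺ ∷ D) i)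

  -- The Bruhat decomposition γ = b₁ c w₀ b₂ is unique, so storing b₁ and b₂
  -- adds no information to γ; μ and μ′ are the projections b₁ and b₂.
  record BruhatCell {m} (D : Vector ℕ⁺ m) : Set (c ⊔ ℓ₁) where
    field
      γ             : Mℤ.Matrix (suc m)
      det-γ         : Mℤ.det γ ≡ ℤ.1ℤ
      b₁ b₂         : Mℝ.Matrix (suc m)
      b₁-unipotent  : Mℝ.UpperUnipotent b₁
      b₂-unipotent  : Mℝ.UpperUnipotent b₂
      decomposition : (λ i j → fromℤ (γ i j))
                      Mℝ.≋ b₁ Mℝ.· torusElement D Mℝ.· Mℝ.longWeyl Mℝ.· b₂

  open BruhatCell

  SameDoubleCoset : ∀ {m} {D : Vector ℕ⁺ m} → Rel (BruhatCell D) _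
  SameDoubleCoset x y = ∃₂ λ u v →
    Mℤ.UpperUnipotent u × Mℤ.UpperUnipotent v × (γ y Mℤ.≋ u Mℤ.· γ x Mℤ.· v)

  -- The finite set X(c) = U(ℤ)\C(c)/U(ℤ), enumerated by choosing one
  -- representative of each double coset.  The sum over X(c) does not depend
  -- on the enumeration, ψ being trivial on U(ℤ).
  record Enumeration {m} (D : Vector ℕ⁺ m) : Set (c ⊔ ℓ₁) where
    field
      size               : ℕ
      representative     : Fin size → BruhatCell D
      representative-inj : Injective _≡_ SameDoubleCoset representative
      representative-sur : StrictlySurjective SameDoubleCoset representative

  module _ (E : Exponential R) where
    open Exponential E using (e)

    ψ : ∀ {m} → Vector ℤ m → Mℝ.Matrix (suc m) → ℂ.Carrier
    ψ N u = e (Mℝ.sum λ i → fromℤ (N i) * u (inject₁ i) (suc i))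

    kloosterman : ∀ {m} {D : Vector ℕ⁺ m} → Enumeration D →
                  Vector ℤ m → Vector ℤ m → ℂ.Carrier
    kloosterman X M N = Matrices.sum (complexes R) λ k →
      ψ (reverse M) (b₁ (representative k)) ℂ.* ψ N (b₂ (representative k))
      where open Enumeration X

{-# OPTIONS --safe #-}

-- Write γ = b₁ c w₀ b₂ and reverse the order of the rows: this is a factorisation
-- L Δ U with L lower and U upper unipotent.  Column operations show that the minor
-- of rows 0,…,k and columns 0,…,k-1,k+1 is Δ₀ ⋯ Δₖ U₍ₖ,ₖ₊₁₎, and Δ₀ ⋯ Δₖ is ± an
-- entry of D; the transpose gives the same for L.  Hence D times a superdiagonal
-- entry of b₁ or b₂ is ± a minor of γ.  So it is an integer, which makes each
-- summand depend only on the residues of M and N; and it is determined by γ, which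
-- replaces uniqueness of the Bruhat decomposition in showing that the summand is
-- constant on double cosets.

module Submission where

open import Defs
open import Algebra.Bundles using (CommutativeMonoid; CommutativeRing)
open import Algebra.Bundles.Raw using (RawRing)
import Algebra.Construct.DirectProduct as Product
import Algebra.Properties.CommutativeMonoid.Sum as CommutativeMonoidSum
import Algebra.Properties.CommutativeSemigroup as CommutativeSemigroupProperties
import Algebra.Properties.Monoid.Mult as MonoidMult
import Algebra.Properties.Ring as RingProperties
import Algebra.Properties.Semiring.Sum as SemiringSum
open import Data.Empty using (⊥-elim)
open import Data.Fin.Base as Fin using (Fin; zero; suc; fromℕ; inject₁; opposite; toℕ)
open import Data.Fin.Permutation using (Permutation; permutation; _⟨$⟩ʳ_)
import Data.Fin.Properties as Fin
open import Data.Integer.Base as ℤ using (ℤ; +_; -[1+_]; _⊖_)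
open import Data.Integer.Divisibility using (_∣_)
import Data.Integer.Divisibility.Signed as Signed
import Data.Integer.Properties as ℤ
open import Data.List.Base using (List; []; _∷_; _++_)
open import Data.List.Relation.Binary.Pointwise.Base using (Pointwise; []; _∷_)
open import Data.List.Relation.Unary.All using (All; []; _∷_)
open import Data.Nat.Base as ℕ using (ℕ; zero; suc; _≤_; z<s; s<s)
import Data.Nat.Properties as ℕ
open import Data.Product.Base using (∃; _×_; _,_; proj₁; proj₂)
open import Data.Vec.Functional as Vector using (Vector; insertAt; reverse)
open import Function.Base using (_∘_; id)
open import Level using (_⊔_)
open import Relation.Binary.Definitions using (tri<; tri≈; tri>)
open import Relation.Binary.PropositionalEquality as ≡ using (_≡_; _≢_)
import Relation.Binary.Reasoning.Setoid as SetoidReasoning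
open import Relation.Nullary using (yes; no)

-- Index lists for minors, and order reversal.

upTo : ∀ {a} {A : Set a} {m} → Vector A (suc m) → Fin m → List A
upTo f zero    = f zero ∷ []
upTo f (suc k) = f zero ∷ upTo (f ∘ suc) k

-- (f₀ , … , fₖ₋₁ , fₖ₊₁)
skipping : ∀ {a} {A : Set a} {m} → Vector A (suc m) → Fin m → List A
skipping f zero    = f (suc zero) ∷ []
skipping f (suc k) = f zero ∷ skipping (f ∘ suc) k

skipping-All : ∀ {a p} {A : Set a} {P : A → Set p} {m} {f : Vector A (suc m)} →
               (∀ i → P (f i)) → ∀ k → All P (skipping f k)
skipping-All Pf zero    = Pf (suc zero) ∷ []
skipping-All Pf (suc k) = Pf zero ∷ skipping-All (Pf ∘ suc) k

skipping-Pointwise : ∀ {a r} {A : Set a} {R : A → A → Set r} {m} {f g : Vector A (suc m)} →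
                     (∀ i → R (f i) (g i)) → ∀ k → Pointwise R (skipping f k) (skipping g k)
skipping-Pointwise Rfg zero    = Rfg (suc zero) ∷ []
skipping-Pointwise Rfg (suc k) = Rfg zero ∷ skipping-Pointwise (Rfg ∘ suc) k

insertAt-fromℕ : ∀ {a} {A : Set a} {m} (xs : Vector A m) (v : A) k →
                 insertAt xs (fromℕ m) v (inject₁ k) ≡ xs k
insertAt-fromℕ xs v zero    = ≡.refl
insertAt-fromℕ xs v (suc k) = insertAt-fromℕ (xs ∘ suc) v k

opposite-inject₁ : ∀ {n} (k : Fin n) → opposite (inject₁ k) ≡ suc (opposite k)
opposite-inject₁ zero    = ≡.refl
opposite-inject₁ (suc k) = ≡.cong inject₁ (opposite-inject₁ k)

opposite-< : ∀ {n} {i j : Fin n} → i Fin.< j → opposite j Fin.< opposite i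
opposite-< {i = i} {j} i<j = ≡.subst₂ ℕ._<_ (≡.sym (Fin.opposite-prop j)) (≡.sym (Fin.opposite-prop i))
  (ℕ.∸-monoʳ-< (ℕ.s<s i<j) (Fin.toℕ<n j))

-- Finite sums with one or two nonzero terms.

module Sums {c ℓ} (C : CommutativeRing c ℓ) where
  open CommutativeRing C hiding (zero)
  open CommutativeMonoidSum +-commutativeMonoid public
  open SemiringSum semiring public using (*-distribˡ-sum; *-distribʳ-sum)
  open SetoidReasoning setoid

  sum-zero : ∀ {n} {f : Vector Carrier n} → (∀ i → f i ≈ 0#) → sum f ≈ 0#
  sum-zero {n} f≈0 = trans (sum-cong-≋ f≈0) (sum-replicate-zero n)

  sum-select : ∀ {n} {f : Vector Carrier n} j → (∀ i → i ≢ j → f i ≈ 0#) → sum f ≈ f j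
  sum-select zero    f≈0 = trans (+-congˡ (sum-zero λ i → f≈0 (suc i) λ ())) (+-identityʳ _)
  sum-select (suc j) f≈0 = trans
    (+-cong (f≈0 zero λ ()) (sum-select j λ i i≢j → f≈0 (suc i) (i≢j ∘ Fin.suc-injective)))
    (+-identityˡ _)

  sum-select₂ : ∀ {m} {f : Vector Carrier (suc m)} (k : Fin m) →
                (∀ i → i Fin.< inject₁ k → f i ≈ 0#) → (∀ i → suc k Fin.< i → f i ≈ 0#) →
                sum f ≈ f (inject₁ k) + f (suc k)
  sum-select₂ {f = f} zero    below above = +-congˡ (trans
    (+-congˡ (sum-zero λ i → above (suc (suc i)) (s<s z<s))) (+-identityʳ (f (suc zero))))
  sum-select₂ (suc k) below above = trans
    (+-cong (below zero z<s)
      (sum-select₂ k (λ i → below (suc i) ∘ s<s) (λ i → above (suc i) ∘ s<s)))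
    (+-identityˡ _)

-- Matrix products and unipotent matrices.

module MatrixProperties {c ℓ} (C : CommutativeRing c ℓ) where
  open CommutativeRing C hiding (zero)
  open Sums C hiding (sum)
  open Matrices rawRing
  open SetoidReasoning setoid

  ≋-sym : ∀ {n} {P Q : Matrix n} → P ≋ Q → Q ≋ P
  ≋-sym P≋Q i j = sym (P≋Q i j)

  ≋-trans : ∀ {n} {P Q S : Matrix n} → P ≋ Q → Q ≋ S → P ≋ S
  ≋-trans P≋Q Q≋S i j = trans (P≋Q i j) (Q≋S i j)

  ·-congʳ : ∀ {n} {P P′ : Matrix n} (Q : Matrix n) → P ≋ P′ → P · Q ≋ P′ · Q
  ·-congʳ Q P≋P′ i j = sum-cong-≋ λ k → *-congʳ (P≋P′ i k)

  ·-congˡ : ∀ {n} (P : Matrix n) {Q Q′ : Matrix n} → Q ≋ Q′ → P · Q ≋ P · Q′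
  ·-congˡ P Q≋Q′ i j = sum-cong-≋ λ k → *-congˡ (Q≋Q′ k j)

  ·-assoc : ∀ {n} (P Q S : Matrix n) → (P · Q) · S ≋ P · (Q · S)
  ·-assoc P Q S i j = begin
    sum (λ l → sum (λ k → P i k * Q k l) * S l j)
      ≈⟨ sum-cong-≋ (λ l → *-distribʳ-sum (S l j) (λ k → P i k * Q k l)) ⟩
    sum (λ l → sum (λ k → P i k * Q k l * S l j))
      ≈⟨ ∑-comm (λ l k → P i k * Q k l * S l j) ⟩
    sum (λ k → sum (λ l → P i k * Q k l * S l j))
      ≈⟨ sum-cong-≋ (λ k → sum-cong-≋ (λ l → *-assoc (P i k) (Q k l) (S l j))) ⟩
    sum (λ k → sum (λ l → P i k * (Q k l * S l j)))
      ≈⟨ sum-cong-≋ (λ k → *-distribˡ-sum (P i k) (λ l → Q k l * S l j)) ⟨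
    sum (λ k → P i k * sum (λ l → Q k l * S l j)) ∎

  ·-diagonal : ∀ {n} (P : Matrix n) d i j → (P · diagonal d) i j ≈ P i j * d j
  ·-diagonal P d i j = trans (sum-select j off) on
    where
    off : ∀ k → k ≢ j → P i k * diagonal d k j ≈ 0#
    off k k≢j with k Fin.≟ j
    ... | yes k≡j = ⊥-elim (k≢j k≡j)
    ... | no  _   = zeroʳ (P i k)
    on : P i j * diagonal d j j ≈ P i j * d j
    on with j Fin.≟ j
    ... | yes _  = refl
    ... | no j≢j = ⊥-elim (j≢j ≡.refl)

  ·-longWeyl : ∀ {n} (P : Matrix n) i j →
               (P · longWeyl) i j ≈ P i (opposite j) * (- 1#) ^ toℕ j
  ·-longWeyl P i j = trans (sum-select (opposite j) off) on
    where
    off : ∀ k → k ≢ opposite j → P i k * longWeyl k j ≈ 0#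
    off k k≢ with k Fin.≟ opposite j
    ... | yes k≡ = ⊥-elim (k≢ k≡)
    ... | no  _  = zeroʳ (P i k)
    on : P i (opposite j) * longWeyl (opposite j) j ≈ P i (opposite j) * (- 1#) ^ toℕ j
    on with opposite j Fin.≟ opposite j
    ... | yes _ = refl
    ... | no ≢  = ⊥-elim (≢ ≡.refl)

  module _ {n} {P Q : Matrix n} (P-uni : UpperUnipotent P) (Q-uni : UpperUnipotent Q) where
    private
      left-zero : ∀ {i j} l → l Fin.< i → P i l * Q l j ≈ 0#
      left-zero {i} {j} l l<i = trans (*-congʳ (proj₂ P-uni i l l<i)) (zeroˡ (Q l j))

      right-zero : ∀ {i j} l → j Fin.< l → P i l * Q l j ≈ 0#
      right-zero {i} {j} l j<l = trans (*-congˡ (proj₂ Q-uni l j j<l)) (zeroʳ (P i l))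

    ·-unipotent : UpperUnipotent (P · Q)
    ·-unipotent .proj₁ i = trans (sum-select i off)
      (trans (*-cong (proj₁ P-uni i) (proj₁ Q-uni i)) (*-identityˡ 1#))
      where
      off : ∀ l → l ≢ i → P i l * Q l i ≈ 0#
      off l l≢i with Fin.<-cmp l i
      ... | tri< l<i _ _ = left-zero l l<i
      ... | tri≈ _ l≡i _ = ⊥-elim (l≢i l≡i)
      ... | tri> _ _ i<l = right-zero l i<l
    ·-unipotent .proj₂ i j j<i = sum-zero λ l → case l
      where
      case : ∀ l → P i l * Q l j ≈ 0#
      case l with l Fin.<? i
      ... | yes l<i = left-zero l l<i
      ... | no  l≮i = right-zero l (ℕ.<-≤-trans j<i (ℕ.≮⇒≥ l≮i))

  -- Row k of `P` starts at column k and column k+1 of `Q` ends at row k+1, so only two products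
  -- survive, each with a diagonal factor 1. This additivity is what makes `ψ` a character.
  ·-superdiagonal : ∀ {m} {P Q : Matrix (suc m)} → UpperUnipotent P → UpperUnipotent Q →
                    ∀ k → (P · Q) (inject₁ k) (suc k) ≈
                          P (inject₁ k) (suc k) + Q (inject₁ k) (suc k)
  ·-superdiagonal {P = P} {Q} (P-diag , P-upper) (Q-diag , Q-upper) k = begin
    (P · Q) (inject₁ k) (suc k)
      ≈⟨ sum-select₂ k (λ l l<k → trans (*-congʳ (P-upper _ l l<k)) (zeroˡ (Q l (suc k))))
                       (λ l k<l → trans (*-congˡ (Q-upper l _ k<l)) (zeroʳ (P (inject₁ k) l))) ⟩
    P (inject₁ k) (inject₁ k) * Q (inject₁ k) (suc k) + P (inject₁ k) (suc k) * Q (suc k) (suc k)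
      ≈⟨ +-cong (trans (*-congʳ (P-diag _)) (*-identityˡ _))
                (trans (*-congˡ (Q-diag _)) (*-identityʳ _)) ⟩
    Q (inject₁ k) (suc k) + P (inject₁ k) (suc k)
      ≈⟨ +-comm _ _ ⟩
    P (inject₁ k) (suc k) + Q (inject₁ k) (suc k) ∎

-- Minors as alternating functions of lists of columns.

module Minors {c ℓ} (C : CommutativeRing c ℓ) (I : Set) where
  open CommutativeRing C hiding (zero)
  open RingProperties ring
  open CommutativeSemigroupProperties (CommutativeMonoid.commutativeSemigroup +-commutativeMonoid) using (interchange)
  open Sums C
  open Matrices rawRing using (Matrix; UpperUnipotent)
  open SetoidReasoning setoid

  -- The rows are indexed by the fixed type `I`, so deleting a row in an induction shortens a list
  -- of indices and leaves the columns themselves unchanged.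
  Column : Set c
  Column = I → Carrier

  infix 4 _≐_
  _≐_ : Column → Column → Set ℓ
  x ≐ y = ∀ i → x i ≈ y i

  ≐-refl : ∀ s → Pointwise _≐_ s s
  ≐-refl []      = []
  ≐-refl (_ ∷ s) = (λ _ → refl) ∷ ≐-refl s

  x-0≈x : ∀ {x y} → y ≈ 0# → x - y ≈ x
  x-0≈x {x} y≈0 = trans (+-congˡ (trans (-‿cong y≈0) -0#≈0#)) (+-identityʳ x)

  -- Laplace expansion of i ∧ f, the coordinate form i being applied to each argument in turn.
  wedge : I → (List Column → Carrier) → List Column → Carrier
  wedge i f []      = 0#
  wedge i f (x ∷ s) = x i * f s - wedge i (f ∘ (x ∷_)) s

  -- The form 1 of degree 0. A form is defined on lists of every length and is extended by zero to
  -- those of the wrong length.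
  empty : List Column → Carrier
  empty []      = 1#
  empty (_ ∷ _) = 0#

  minor : List I → List Column → Carrier
  minor []       = empty
  minor (i ∷ is) = wedge i (minor is)

  -- `linear` combines additivity and homogeneity in the shape of a column operation. Vanishing is
  -- required at adjacent equal arguments only, which passes easily through `wedge`; antisymmetry
  -- follows in `swap`.
  record Alternating (f : List Column → Carrier) : Set (c ⊔ ℓ) where
    field
      cong     : ∀ {s t} → Pointwise _≐_ s t → f s ≈ f t
      linear   : ∀ p x a y s → f (p ++ (λ i → x i + a * y i) ∷ s) ≈
                                f (p ++ x ∷ s) + a * f (p ++ y ∷ s)
      adjacent : ∀ p x s → f (p ++ x ∷ x ∷ s) ≈ 0#

  open Alternating

  -- The prefix `p` in the axioms exists for this: the fixed argument joins it. The recursion in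
  -- `wedge` moves one argument at a time into the form, so proofs about it recurse through `fix`.
  fix : ∀ {f} → Alternating f → ∀ x → Alternating (f ∘ (x ∷_))
  fix alt x .cong s≐t  = alt .cong ((λ _ → refl) ∷ s≐t)
  fix alt x .linear p  = alt .linear (x ∷ p)
  fix alt x .adjacent p = alt .adjacent (x ∷ p)

  wedge-cong : ∀ i {f g} → (∀ s → f s ≈ g s) → ∀ s → wedge i f s ≈ wedge i g s
  wedge-cong i f≈g []      = refl
  wedge-cong i f≈g (x ∷ s) =
    +-cong (*-congˡ (f≈g s)) (-‿cong (wedge-cong i (f≈g ∘ (x ∷_)) s))

  wedge-zero : ∀ i {f} → (∀ s → f s ≈ 0#) → ∀ s → wedge i f s ≈ 0#
  wedge-zero i f≈0 []      = refl
  wedge-zero i f≈0 (x ∷ s) =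
    trans (x-0≈x (wedge-zero i (f≈0 ∘ (x ∷_)) s)) (trans (*-congˡ (f≈0 s)) (zeroʳ (x i)))

  -- Each term of the expansion contains a factor `x i`. In an expansion along row i whose first
  -- column alone is nonzero there, this removes everything after the first term.
  wedge-vanishing : ∀ i f {s} → All (λ x → x i ≈ 0#) s → wedge i f s ≈ 0#
  wedge-vanishing i f []               = refl
  wedge-vanishing i f (_∷_ {x} x≈0 s≈0) =
    trans (x-0≈x (wedge-vanishing i (f ∘ (x ∷_)) s≈0)) (trans (*-congʳ x≈0) (zeroˡ _))

  -‿linear : ∀ {w x y z a u v} → u ≈ w + a * x → v ≈ y + a * z →
             u - v ≈ (w - y) + a * (x - z)
  -‿linear {w} {x} {y} {z} {a} {u} {v} u≈ v≈ = begin
    u - v                              ≈⟨ +-cong u≈ (-‿cong v≈) ⟩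
    (w + a * x) - (y + a * z)          ≈⟨ +-congˡ (-‿+-comm y (a * z)) ⟨
    (w + a * x) + (- y - a * z)        ≈⟨ interchange w (a * x) (- y) (- (a * z)) ⟩
    (w - y) + (a * x - a * z)          ≈⟨ +-congˡ (x[y-z]≈xy-xz a x z) ⟨
    (w - y) + a * (x - z)              ∎

  *-linear : ∀ {r p q a s} → s ≈ p + a * q → r * s ≈ r * p + a * (r * q)
  *-linear {r} {p} {q} {a} {s} s≈ = begin
    r * s                ≈⟨ *-congˡ s≈ ⟩
    r * (p + a * q)      ≈⟨ distribˡ r p (a * q) ⟩
    r * p + r * (a * q)  ≈⟨ +-congˡ (*-assoc r a q) ⟨
    r * p + r * a * q    ≈⟨ +-congˡ (*-congʳ (*-comm r a)) ⟩
    r * p + a * r * q    ≈⟨ +-congˡ (*-assoc a r q) ⟩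
    r * p + a * (r * q)  ∎

  -- Linearity in the form rather than in a column. It handles a modified first column, which the
  -- second part of the expansion has absorbed into the form.
  wedge-linear : ∀ i {f g h a} → (∀ s → h s ≈ f s + a * g s) →
                 ∀ s → wedge i h s ≈ wedge i f s + a * wedge i g s
  wedge-linear i {a = a} h≈ []      = sym (trans (+-congˡ (zeroʳ a)) (+-identityˡ 0#))
  wedge-linear i h≈ (x ∷ s) =
    -‿linear (*-linear (h≈ s)) (wedge-linear i (h≈ ∘ (x ∷_)) s)

  wedge-alternating : ∀ i {f} → Alternating f → Alternating (wedge i f)
  wedge-alternating i alt .cong = go alt
    where
    go : ∀ {f} → Alternating f → ∀ {s t} → Pointwise _≐_ s t → wedge i f s ≈ wedge i f t
    go alt []                            = refl
    go alt (_∷_ {x} {y} {s} {t} x≐y s≐t) =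
      +-cong (*-cong (x≐y i) (alt .cong s≐t))
        (-‿cong (trans (go (fix alt x) s≐t)
          (wedge-cong i (λ u → alt .cong (x≐y ∷ ≐-refl u)) t)))
  wedge-alternating i {f} alt .linear = go alt
    where
    go : ∀ {f} → Alternating f → ∀ p x a y s → wedge i f (p ++ (λ j → x j + a * y j) ∷ s) ≈
         wedge i f (p ++ x ∷ s) + a * wedge i f (p ++ y ∷ s)
    go {f} alt [] x a y s      =
      -‿linear (trans (distribʳ (f s) (x i) (a * y i)) (+-congˡ (*-assoc a (y i) (f s))))
               (wedge-linear i (alt .linear [] x a y) s)
    go alt (z ∷ p) x a y s =
      -‿linear (*-linear (alt .linear p x a y s)) (go (fix alt z) p x a y s)
  wedge-alternating i alt .adjacent = go alt
    where
    go : ∀ {f} → Alternating f → ∀ p x s → wedge i f (p ++ x ∷ x ∷ s) ≈ 0#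
    -- The two terms that remove one copy of `x` cancel. The remaining terms, collected in `w`, keep
    -- both copies as adjacent arguments of `f` and vanish.
    go {f} alt [] x s = begin
      r - (r - w)  ≈⟨ +-congˡ (-‿cong (x-0≈x (wedge-zero i (alt .adjacent [] x) s))) ⟩
      r - r        ≈⟨ -‿inverseʳ r ⟩
      0#           ∎
      where r = x i * f (x ∷ s)
            w = wedge i (λ t → f (x ∷ x ∷ t)) s
    go alt (z ∷ p) x s =
      trans (x-0≈x (go (fix alt z) p x s)) (trans (*-congˡ (alt .adjacent p x s)) (zeroʳ (z i)))

  empty-alternating : Alternating empty
  empty-alternating .cong []      = refl
  empty-alternating .cong (_ ∷ _) = refl
  empty-alternating .linear [] x a y s      = sym (trans (+-congˡ (zeroʳ a)) (+-identityˡ 0#))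
  empty-alternating .linear (_ ∷ _) x a y s = sym (trans (+-congˡ (zeroʳ a)) (+-identityˡ 0#))
  empty-alternating .adjacent [] x s      = refl
  empty-alternating .adjacent (_ ∷ _) x s = refl

  minor-alternating : ∀ is → Alternating (minor is)
  minor-alternating []       = empty-alternating
  minor-alternating (i ∷ is) = wedge-alternating i (minor-alternating is)

  -- A minor is an integer polynomial in the entries, built from 0, 1, products and differences.
  -- Applied to `Integral`, this makes the minors of an integer matrix integral.
  minor-closed : ∀ {p} (P : Carrier → Set p) → P 0# → P 1# →
                 (∀ {x y} → P x → P y → P (x * y)) → (∀ {x y} → P x → P y → P (x - y)) →
                 ∀ is {s} → All (λ x → ∀ i → P (x i)) s → P (minor is s)
  minor-closed P P0 P1 P* P- []       []      = P1
  minor-closed P P0 P1 P* P- []       (_ ∷ _) = P0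
  minor-closed P P0 P1 P* P- (i ∷ is) = go (minor-closed P P0 P1 P* P- is)
    where
    go : ∀ {f} → (∀ {s} → All (λ x → ∀ j → P (x j)) s → P (f s)) →
         ∀ {s} → All (λ x → ∀ j → P (x j)) s → P (wedge i f s)
    go Pf []        = P0
    go Pf (Px ∷ Ps) = P- (P* (Px i) (Pf Ps)) (go (λ Pt → Pf (Px ∷ Pt)) Ps)

  -- Polarisation: with z = x + y in both places the value is 0, and expanding leaves only the two
  -- mixed terms.
  swap : ∀ {f} → Alternating f → ∀ x y s → f (x ∷ y ∷ s) ≈ - f (y ∷ x ∷ s)
  swap {f} alt x y s = +-inverseˡ-unique _ _ (begin
    f (x ∷ y ∷ s) + f (y ∷ x ∷ s)       ≈⟨ +-cong expandˣ expandʸ ⟨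
    f (x ∷ z ∷ s) + 1# * f (y ∷ z ∷ s)  ≈⟨ alt .linear [] x 1# y (z ∷ s) ⟨
    f (z ∷ z ∷ s)                       ≈⟨ alt .adjacent [] z s ⟩
    0#                                  ∎)
    where
    z = λ i → x i + 1# * y i
    expandˣ : f (x ∷ z ∷ s) ≈ f (x ∷ y ∷ s)
    expandˣ = begin
      f (x ∷ z ∷ s)                       ≈⟨ alt .linear (x ∷ []) x 1# y s ⟩
      f (x ∷ x ∷ s) + 1# * f (x ∷ y ∷ s)  ≈⟨ +-cong (alt .adjacent [] x s) (*-identityˡ _) ⟩
      0# + f (x ∷ y ∷ s)                  ≈⟨ +-identityˡ _ ⟩
      f (x ∷ y ∷ s)                       ∎
    expandʸ : 1# * f (y ∷ z ∷ s) ≈ f (y ∷ x ∷ s)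
    expandʸ = begin
      1# * f (y ∷ z ∷ s)                  ≈⟨ *-identityˡ _ ⟩
      f (y ∷ z ∷ s)                       ≈⟨ alt .linear (y ∷ []) x 1# y s ⟩
      f (y ∷ x ∷ s) + 1# * f (y ∷ y ∷ s)  ≈⟨ +-congˡ (*-congˡ (alt .adjacent [] y s)) ⟩
      f (y ∷ x ∷ s) + 1# * 0#             ≈⟨ +-congˡ (zeroʳ 1#) ⟩
      f (y ∷ x ∷ s) + 0#                  ≈⟨ +-identityʳ _ ⟩
      f (y ∷ x ∷ s)                       ∎

  -- Only adjacent arguments are related by alternation, so x is swapped past each modified column.
  shear : ∀ {f} → Alternating f → ∀ x {s t} →
          Pointwise (λ y z → ∃ λ a → z ≐ (λ i → y i + a * x i)) s t → f (x ∷ t) ≈ f (x ∷ s)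
  shear alt x []                                       = refl
  shear {f} alt x (_∷_ {y} {z} {s} {t} (a , z≐) s~t) = begin
    f (x ∷ z ∷ t)                          ≈⟨ alt .cong ((λ _ → refl) ∷ z≐ ∷ ≐-refl t) ⟩
    f (x ∷ (λ i → y i + a * x i) ∷ t)      ≈⟨ alt .linear (x ∷ []) y a x t ⟩
    f (x ∷ y ∷ t) + a * f (x ∷ x ∷ t)      ≈⟨ +-congˡ (*-congˡ (alt .adjacent [] x t)) ⟩
    f (x ∷ y ∷ t) + a * 0#                 ≈⟨ +-congˡ (zeroʳ a) ⟩
    f (x ∷ y ∷ t) + 0#                     ≈⟨ +-identityʳ _ ⟩
    f (x ∷ y ∷ t)                          ≈⟨ swap alt x y t ⟩
    - f (y ∷ x ∷ t)                        ≈⟨ -‿cong (shear (fix alt y) x s~t) ⟩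
    - f (y ∷ x ∷ s)                        ≈⟨ swap alt x y s ⟨
    f (x ∷ y ∷ s)                          ∎

  -- Minors of a triangular factorisation.

  productTo : ∀ {m} → Vector Carrier (suc m) → Fin m → Carrier
  productTo Δ zero    = Δ zero
  productTo Δ (suc k) = Δ zero * productTo (Δ ∘ suc) k

  productTo-closed : ∀ {p} (P : Carrier → Set p) → (∀ {x y} → P x → P y → P (x * y)) →
                     ∀ {m} {Δ : Vector Carrier (suc m)} → (∀ i → P (Δ i)) →
                     ∀ k → P (productTo Δ k)
  productTo-closed P P* PΔ zero    = PΔ zero
  productTo-closed P P* PΔ (suc k) = P* (PΔ zero) (productTo-closed P P* (PΔ ∘ suc) k)

  -- Each Δ is ε times the quotient of two successive entries of `d`, so their product telescopes.
  -- Cross-multiplying keeps the statement free of division.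
  telescope : ∀ {m} (d : Vector Carrier (suc m)) {Δ ε : Vector Carrier (suc m)} →
              (∀ k → d (inject₁ k) * Δ (inject₁ k) ≈ ε (inject₁ k) * d (suc k)) →
              ∀ k → d zero * productTo Δ k ≈ productTo ε k * d (suc k)
  telescope d         dΔ≈εd zero    = dΔ≈εd zero
  telescope d {Δ} {ε} dΔ≈εd (suc k) = begin
    d zero * (Δ zero * Π)              ≈⟨ *-assoc _ _ _ ⟨
    d zero * Δ zero * Π                ≈⟨ *-congʳ (dΔ≈εd zero) ⟩
    ε zero * d (suc zero) * Π          ≈⟨ *-assoc _ _ _ ⟩
    ε zero * (d (suc zero) * Π)        ≈⟨ *-congˡ (telescope (d ∘ suc) (dΔ≈εd ∘ suc) k) ⟩
    ε zero * (productTo (ε ∘ suc) k * d (suc (suc k))) ≈⟨ *-assoc _ _ _ ⟨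
    productTo ε (suc k) * d (suc (suc k)) ∎
    where Π = productTo (Δ ∘ suc) k

  -- With rows in the order ρ, the columns `A` form a lower triangular matrix with diagonal Δ, and
  -- the minor is taken from its product with `U`. By induction on k: column 0 of the product is
  -- `A zero`; subtracting its multiples clears row ρ₀ from the other columns, and expanding along
  -- that row leaves the same problem one size smaller. For k = 0 the minor is the single entry in
  -- row ρ₀ and column 1.
  minor-LU : ∀ {m} (ρ : Vector I (suc m)) (A : Vector Column (suc m)) (Δ : Vector Carrier (suc m))
             {U : Matrix (suc m)} → UpperUnipotent U →
             (∀ {i j} → i Fin.< j → A j (ρ i) ≈ 0#) → (∀ i → A i (ρ i) ≈ Δ i) →
             ∀ k → minor (upTo ρ k) (skipping (λ j p → sum λ l → A l p * U l j) k) ≈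
                   productTo Δ k * U (inject₁ k) (suc k)
  minor-LU ρ A Δ {U} U-uni A-lower A-diag zero = begin
    y * 1# - 0#                     ≈⟨ x-0≈x refl ⟩
    y * 1#                          ≈⟨ *-identityʳ y ⟩
    y                               ≈⟨ +-cong (*-congʳ (A-diag zero)) (sum-zero λ l →
                                         trans (*-congʳ (A-lower {zero} {suc l} z<s)) (zeroˡ (U (suc l) (suc zero)))) ⟩
    Δ zero * U zero (suc zero) + 0# ≈⟨ +-identityʳ _ ⟩
    Δ zero * U zero (suc zero)      ∎
    where y = sum λ l → A l (ρ zero) * U l (suc zero)
  minor-LU ρ A Δ {U} (U-diag , U-upper) A-lower A-diag (suc k) = begin
    minor (upTo ρ (suc k)) (C₀ ∷ skipping C₊ k)
      ≈⟨ alt .cong (C₀≐A₀ ∷ ≐-refl (skipping C₊ k)) ⟩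
    minor (upTo ρ (suc k)) (A zero ∷ skipping C₊ k)
      ≈⟨ shear alt (A zero) (skipping-Pointwise (λ j → U zero (suc j) , C₊≐ j) k) ⟩
    minor (upTo ρ (suc k)) (A zero ∷ skipping C′ k)
      ≈⟨ x-0≈x (wedge-vanishing (ρ zero) _ (skipping-All C′-vanishes k)) ⟩
    A zero (ρ zero) * minor (upTo (ρ ∘ suc) k) (skipping C′ k)
      ≈⟨ *-cong (A-diag zero) (minor-LU (ρ ∘ suc) (A ∘ suc) (Δ ∘ suc)
           ((λ i → U-diag (suc i)) , λ i j j<i → U-upper (suc i) (suc j) (s<s j<i))
           (A-lower ∘ s<s) (A-diag ∘ suc) k) ⟩
    Δ zero * (productTo (Δ ∘ suc) k * U (suc (inject₁ k)) (suc (suc k)))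
      ≈⟨ *-assoc _ _ _ ⟨
    productTo Δ (suc k) * U (suc (inject₁ k)) (suc (suc k)) ∎
    where
    alt = minor-alternating (upTo ρ (suc k))
    C₀ = λ p → sum λ l → A l p * U l zero
    C₊ = λ j p → sum λ l → A l p * U l (suc j)
    -- The later columns with their `A zero` component removed. They are the columns of the product
    -- of the smaller matrices, so the induction hypothesis applies to them directly.
    C′ = λ j p → sum λ l → A (suc l) p * U (suc l) (suc j)
    C₀≐A₀ : C₀ ≐ A zero
    C₀≐A₀ p = trans
      (+-cong (trans (*-congˡ (U-diag zero)) (*-identityʳ _))
              (sum-zero λ l → trans (*-congˡ (U-upper (suc l) zero z<s)) (zeroʳ (A (suc l) p))))
      (+-identityʳ (A zero p))
    C₊≐ : ∀ j → C₊ j ≐ (λ p → C′ j p + U zero (suc j) * A zero p)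
    C₊≐ j p = trans (+-comm _ _) (+-congˡ (*-comm _ _))
    C′-vanishes : ∀ j → C′ j (ρ zero) ≈ 0#
    C′-vanishes j = sum-zero λ l → trans (*-congʳ (A-lower {zero} {suc l} z<s)) (zeroˡ (U (suc l) (suc j)))

-- The embedding of ℤ in ℝ as a ring homomorphism.

private
  module ℤ-Ring = RingProperties ℤ.+-*-ring
  module ℤ-Matrix = MatrixProperties ℤ.+-*-commutativeRing

module RealProperties {c ℓ₁ ℓ₂} (R : Reals c ℓ₁ ℓ₂) where
  open Reals R hiding (+-identityˡ)

  ℝ : CommutativeRing c ℓ₁
  ℝ = record { isCommutativeRing = isCommutativeRing }

  open CommutativeRing ℝ hiding (zero; Carrier; _≈_; _+_; _*_; -_; 0#; 1#; rawRing; isCommutativeRing)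
  open RingProperties ring
  open Sums ℝ hiding (sum)
  open Matrices rawRing
  open SetoidReasoning setoid

  fromNat-+ : ∀ m n → fromNat (m ℕ.+ n) ≈ fromNat m + fromNat n
  fromNat-+ = MonoidMult.×-homo-+ +-monoid 1#

  fromNat-1 : fromNat 1 ≈ 1#
  fromNat-1 = +-identityʳ 1#

  fromℤ-neg : ∀ z → fromℤ (ℤ.- z) ≈ - fromℤ z
  fromℤ-neg (+ zero)  = sym -0#≈0#
  fromℤ-neg (+ suc k) = refl
  fromℤ-neg -[1+ k ]  = sym (-‿involutive _)

  fromℤ-⊖ : ∀ m n → fromℤ (m ⊖ n) ≈ fromNat m - fromNat n
  fromℤ-⊖ m       zero    = sym (trans (+-congˡ -0#≈0#) (+-identityʳ _))
  fromℤ-⊖ zero    (suc n) = sym (+-identityˡ _)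
  fromℤ-⊖ (suc m) (suc n) = begin
    fromℤ (suc m ⊖ suc n)                   ≈⟨ reflexive (≡.cong fromℤ (ℤ.[1+m]⊖[1+n]≡m⊖n m n)) ⟩
    fromℤ (m ⊖ n)                           ≈⟨ fromℤ-⊖ m n ⟩
    fromNat m - fromNat n                   ≈⟨ +-congʳ (xyx⁻¹≈y 1# (fromNat m)) ⟨
    1# + fromNat m - 1# - fromNat n         ≈⟨ +-assoc _ _ _ ⟩
    (1# + fromNat m) + (- 1# - fromNat n)   ≈⟨ +-congˡ (-‿+-comm 1# (fromNat n)) ⟩
    (1# + fromNat m) - (1# + fromNat n)     ∎

  fromℤ-+ : ∀ y z → fromℤ (y ℤ.+ z) ≈ fromℤ y + fromℤ z
  fromℤ-+ (+ m)    (+ n)    = fromNat-+ m n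
  fromℤ-+ (+ m)    -[1+ n ] = fromℤ-⊖ m (suc n)
  fromℤ-+ -[1+ m ] (+ n)    = trans (fromℤ-⊖ n (suc m)) (+-comm _ _)
  fromℤ-+ -[1+ m ] -[1+ n ] = begin
    - fromNat (suc (suc (m ℕ.+ n)))        ≈⟨ reflexive (≡.cong (-_ ∘ fromNat ∘ suc) (ℕ.+-suc m n)) ⟨
    - fromNat (suc m ℕ.+ suc n)            ≈⟨ -‿cong (fromNat-+ (suc m) (suc n)) ⟩
    - (fromNat (suc m) + fromNat (suc n))  ≈⟨ -‿+-comm _ _ ⟨
    - fromNat (suc m) - fromNat (suc n)    ∎

  fromℤ-- : ∀ y z → fromℤ (y ℤ.- z) ≈ fromℤ y - fromℤ z
  fromℤ-- y z = trans (fromℤ-+ y (ℤ.- z)) (+-congˡ (fromℤ-neg z))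

  fromℤ-+* : ∀ m z → fromℤ (+ m ℤ.* z) ≈ fromNat m * fromℤ z
  fromℤ-+* zero    z = sym (zeroˡ (fromℤ z))
  fromℤ-+* (suc m) z = begin
    fromℤ (+ suc m ℤ.* z)                ≈⟨ reflexive (≡.cong fromℤ (ℤ.suc-* (+ m) z)) ⟩
    fromℤ (z ℤ.+ + m ℤ.* z)              ≈⟨ fromℤ-+ z _ ⟩
    fromℤ z + fromℤ (+ m ℤ.* z)          ≈⟨ +-cong (sym (*-identityˡ _)) (fromℤ-+* m z) ⟩
    1# * fromℤ z + fromNat m * fromℤ z   ≈⟨ distribʳ (fromℤ z) 1# (fromNat m) ⟨
    fromNat (suc m) * fromℤ z            ∎

  fromℤ-* : ∀ y z → fromℤ (y ℤ.* z) ≈ fromℤ y * fromℤ z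
  fromℤ-* (+ m)    z = fromℤ-+* m z
  fromℤ-* -[1+ m ] z = begin
    fromℤ (-[1+ m ] ℤ.* z)         ≈⟨ reflexive (≡.cong fromℤ (ℤ.neg-distribˡ-* (+ suc m) z)) ⟨
    fromℤ (ℤ.- (+ suc m ℤ.* z))    ≈⟨ fromℤ-neg (+ suc m ℤ.* z) ⟩
    - fromℤ (+ suc m ℤ.* z)        ≈⟨ -‿cong (fromℤ-+* (suc m) z) ⟩
    - (fromNat (suc m) * fromℤ z)  ≈⟨ -‿distribˡ-* _ _ ⟩
    - fromNat (suc m) * fromℤ z    ∎

  fromℤ-sum : ∀ {n} (f : Vector ℤ n) → fromℤ (Mℤ.sum f) ≈ sum (fromℤ ∘ f)
  fromℤ-sum {zero}  f = refl
  fromℤ-sum {suc n} f = trans (fromℤ-+ (f zero) _) (+-congˡ (fromℤ-sum (f ∘ suc)))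

  real : ∀ {n} → Mℤ.Matrix n → Matrix n
  real P i j = fromℤ (P i j)

  real-· : ∀ {n} (P Q : Mℤ.Matrix n) → real (P Mℤ.· Q) ≋ real P · real Q
  real-· P Q i j = trans (fromℤ-sum λ k → P i k ℤ.* Q k j) (sum-cong-≋ λ k → fromℤ-* (P i k) (Q k j))

  real-unipotent : ∀ {n} {P : Mℤ.Matrix n} → Mℤ.UpperUnipotent P → UpperUnipotent (real P)
  real-unipotent (diag , upper) =
    (λ i → trans (reflexive (≡.cong fromℤ (diag i))) fromNat-1) ,
    (λ i j j<i → reflexive (≡.cong fromℤ (upper i j j<i)))

  -- Congruence modulo ℤ and integral real numbers.

  infix 4 _∼_
  _∼_ : Carrier → Carrier → Set ℓ₁
  x ∼ y = ∃ λ z → x ≈ y + fromℤ z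

  Integral : Carrier → Set ℓ₁
  Integral x = ∃ λ z → x ≈ fromℤ z

  ≈-Integral : ∀ {x y} → x ≈ y → Integral y → Integral x
  ≈-Integral x≈y (z , y≈z) = z , trans x≈y y≈z

  Integral-0 : Integral 0#
  Integral-0 = + 0 , refl

  Integral-1 : Integral 1#
  Integral-1 = + 1 , sym fromNat-1

  Integral-- : ∀ {x y} → Integral x → Integral y → Integral (x - y)
  Integral-- (y , ≈y) (z , ≈z) = y ℤ.- z , trans (+-cong ≈y (-‿cong ≈z)) (sym (fromℤ-- y z))

  Integral-* : ∀ {x y} → Integral x → Integral y → Integral (x * y)
  Integral-* (y , ≈y) (z , ≈z) = y ℤ.* z , trans (*-cong ≈y ≈z) (sym (fromℤ-* y z))

  ∼-sum : ∀ {n} {f g : Vector Carrier n} → (∀ i → f i ∼ g i) → sum f ∼ sum g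
  ∼-sum {f = f} {g} f∼g = Mℤ.sum z , (begin
    sum f                              ≈⟨ sum-cong-≋ (proj₂ ∘ f∼g) ⟩
    sum (λ i → g i + fromℤ (z i))      ≈⟨ ∑-distrib-+ g (fromℤ ∘ z) ⟩
    sum g + sum (fromℤ ∘ z)            ≈⟨ +-congˡ (fromℤ-sum z) ⟨
    sum g + fromℤ (Mℤ.sum z)           ∎)
    where z = proj₁ ∘ f∼g

  ∼-*ˡ : ∀ a {x y} → x ∼ y → fromℤ a * x ∼ fromℤ a * y
  ∼-*ˡ a {x} {y} (z , x≈) = a ℤ.* z , (begin
    fromℤ a * x                       ≈⟨ *-congˡ x≈ ⟩
    fromℤ a * (y + fromℤ z)           ≈⟨ distribˡ _ _ _ ⟩
    fromℤ a * y + fromℤ a * fromℤ z   ≈⟨ +-congˡ (fromℤ-* a z) ⟨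
    fromℤ a * y + fromℤ (a ℤ.* z)     ∎)

  -- If a - b = q d, then (a - b) x = q (d x), an integer. This is how a congruence modulo an entry
  -- of `D` becomes equality of exponentials: x will be a superdiagonal entry whose denominator d
  -- clears.
  ∼-*ʳ : ∀ {d a b x} → + d ∣ a ℤ.- b → Integral (fromNat d * x) → fromℤ a * x ∼ fromℤ b * x
  ∼-*ʳ {d} {a} {b} {x} d∣a-b (z , dx≈z) with Signed.∣ᵤ⇒∣ d∣a-b
  ... | Signed.divides q a-b≡qd = q ℤ.* z , (begin
    fromℤ a * x                                ≈⟨ *-congʳ (reflexive (≡.cong fromℤ a≡)) ⟩
    fromℤ (b ℤ.+ q ℤ.* + d) * x                ≈⟨ *-congʳ (fromℤ-+ b _) ⟩
    (fromℤ b + fromℤ (q ℤ.* + d)) * x          ≈⟨ distribʳ x _ _ ⟩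
    fromℤ b * x + fromℤ (q ℤ.* + d) * x        ≈⟨ +-congˡ (*-congʳ (fromℤ-* q (+ d))) ⟩
    fromℤ b * x + fromℤ q * fromNat d * x      ≈⟨ +-congˡ (*-assoc _ _ _) ⟩
    fromℤ b * x + fromℤ q * (fromNat d * x)    ≈⟨ +-congˡ (*-congˡ dx≈z) ⟩
    fromℤ b * x + fromℤ q * fromℤ z            ≈⟨ +-congˡ (fromℤ-* q z) ⟨
    fromℤ b * x + fromℤ (q ℤ.* z)              ∎)
    where
    a≡ : a ≡ b ℤ.+ q ℤ.* + d
    a≡ = ≡.trans (≡.sym (≡.trans (≡.sym (ℤ.+-assoc b a (ℤ.- b))) (ℤ-Ring.xyx⁻¹≈y b a))) (≡.cong (λ y → b ℤ.+ y) a-b≡qd)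

  fraction-cancel : ∀ a b → fraction a b * fromNat (proj₁ b) ≈ fromNat (proj₁ a)
  fraction-cancel (a , _) (suc b , _) with reciprocal (0<fromNat b)
  ... | y , by≈1 = trans (*-assoc _ _ _)
    (trans (*-congˡ (trans (*-comm _ _) by≈1)) (*-identityʳ _))

  fromNat-cancel : ∀ (d : ℕ⁺) {x y} → fromNat (proj₁ d) * x ≈ fromNat (proj₁ d) * y → x ≈ y
  fromNat-cancel (suc d , _) {x} {y} dx≈dy with reciprocal (0<fromNat d)
  ... | r , dr≈1 = begin
    x                          ≈⟨ lemma x ⟨
    r * (fromNat (suc d) * x)  ≈⟨ *-congˡ dx≈dy ⟩
    r * (fromNat (suc d) * y)  ≈⟨ lemma y ⟩
    y                          ∎
    where
    lemma : ∀ x → r * (fromNat (suc d) * x) ≈ x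
    lemma x = trans (sym (*-assoc _ _ _)) (trans (*-congʳ (trans (*-comm _ _) dr≈1)) (*-identityˡ x))

-- Superdiagonal entries of the Bruhat factors as minors.

module BruhatProperties {c ℓ₁ ℓ₂} (R : Reals c ℓ₁ ℓ₂) {m} (D : Vector ℕ⁺ m) where
  open Reals R hiding (+-identityˡ)
  open RealProperties R
  open CommutativeRing ℝ hiding (zero; Carrier; _≈_; _+_; _*_; -_; 0#; 1#; rawRing; isCommutativeRing; _-_)
  open RingProperties ring
  open Sums ℝ hiding (sum)
  open Minors ℝ (Fin (suc m))
  open Alternating
  open Matrices rawRing
  open MatrixProperties ℝ
  open SetoidReasoning setoid

  numerator denominator : Vector ℕ⁺ (suc m)
  numerator   = insertAt D (fromℕ m) 1⁺
  denominator = 1⁺ Vector.∷ D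

  torus : Vector Carrier (suc m)
  torus i = fraction (reverse numerator i) (reverse denominator i)

  T : Matrix (suc m)
  T = torusElement R D

  -- The matrix c w₀ with its rows reversed is diagonal with entries Δ: column l of w₀ has its only
  -- entry, `sign l`, in row `opposite l`.
  sign Δ : Vector Carrier (suc m)
  sign l = (- 1#) ^ toℕ l
  Δ l    = torus (opposite l) * sign l

  -- The `opposite` in Δ undoes the `reverse` in the torus element, so Δ is, up to sign, the
  -- quotient of an entry of `D` by the preceding one, the first being divided by 1.
  Δ-ratio : ∀ k → fromNat (proj₁ (denominator (inject₁ k))) * Δ (inject₁ k) ≈
                  sign (inject₁ k) * fromNat (proj₁ (D k))
  Δ-ratio k = begin
    d * (torus (opposite l) * sign l)
      ≈⟨ *-congˡ (*-congʳ (reflexive (≡.cong (λ i → fraction (numerator i) (denominator i))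
           (Fin.opposite-involutive l)))) ⟩
    d * (fraction (numerator l) (denominator l) * sign l)
      ≈⟨ *-assoc _ _ _ ⟨
    d * fraction (numerator l) (denominator l) * sign l
      ≈⟨ *-comm _ _ ⟩
    sign l * (d * fraction (numerator l) (denominator l))
      ≈⟨ *-congˡ (*-comm _ _) ⟩
    sign l * (fraction (numerator l) (denominator l) * d)
      ≈⟨ *-congˡ (fraction-cancel (numerator l) (denominator l)) ⟩
    sign l * fromNat (proj₁ (numerator l))
      ≈⟨ *-congˡ (reflexive (≡.cong (fromNat ∘ proj₁) (insertAt-fromℕ D 1⁺ k))) ⟩
    sign l * fromNat (proj₁ (D k)) ∎
    where
    l = inject₁ k
    d = fromNat (proj₁ (denominator l))

  productTo-Δ : ∀ k → productTo Δ k ≈ productTo sign k * fromNat (proj₁ (D k))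
  productTo-Δ k = begin
    productTo Δ k                                ≈⟨ *-identityˡ _ ⟨
    1# * productTo Δ k                           ≈⟨ *-congʳ fromNat-1 ⟨
    -- The factor `fromNat 1` is the first denominator, D₀ = 1, where the telescoping starts.
    fromNat 1 * productTo Δ k                    ≈⟨ telescope (fromNat ∘ proj₁ ∘ denominator) Δ-ratio k ⟩
    productTo sign k * fromNat (proj₁ (D k))     ∎

  -- The numbers 1 and -1, described by what is used: integrality keeps a signed minor integral, and
  -- square 1 lets a sign cross an equation.
  Unit : Carrier → Set ℓ₁
  Unit x = Integral x × x * x ≈ 1#

  Unit-* : ∀ {x y} → Unit x → Unit y → Unit (x * y)
  Unit-* {x} {y} (xz , x²) (yz , y²) = Integral-* xz yz , (begin
    x * y * (x * y)    ≈⟨ *-congʳ (*-comm x y) ⟩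
    y * x * (x * y)    ≈⟨ *-assoc y x (x * y) ⟩
    y * (x * (x * y))  ≈⟨ *-congˡ (*-assoc x x y) ⟨
    y * (x * x * y)    ≈⟨ *-congˡ (trans (*-congʳ x²) (*-identityˡ y)) ⟩
    y * y              ≈⟨ y² ⟩
    1#                 ∎)

  Unit--1 : Unit (- 1#)
  Unit--1 = (-[1+ 0 ] , -‿cong (sym fromNat-1)) , trans (-1*x≈-x (- 1#)) (-‿involutive 1#)

  sign-unit : ∀ l → Unit (sign l)
  sign-unit l = go (toℕ l)
    where
    go : ∀ k → Unit ((- 1#) ^ k)
    go zero    = Integral-1 , *-identityˡ 1#
    go (suc k) = Unit-* Unit--1 (go k)

  productTo-sign-unit : ∀ k → Unit (productTo sign k)
  productTo-sign-unit = productTo-closed Unit Unit-* sign-unit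

  unscale : ∀ k {x y} → y ≈ productTo Δ k * x →
            fromNat (proj₁ (D k)) * x ≈ productTo sign k * y
  unscale k {x} {y} y≈ = sym (begin
    ε * y              ≈⟨ *-congˡ (trans y≈ (*-congʳ (productTo-Δ k))) ⟩
    ε * (ε * d * x)    ≈⟨ *-congˡ (*-assoc ε d x) ⟩
    ε * (ε * (d * x))  ≈⟨ *-assoc ε ε (d * x) ⟨
    ε * ε * (d * x)    ≈⟨ *-congʳ (proj₂ (productTo-sign-unit k)) ⟩
    1# * (d * x)       ≈⟨ *-identityˡ _ ⟩
    d * x              ∎)
    where
    ε = productTo sign k
    d = fromNat (proj₁ (D k))

  bruhat-entry : ∀ P Q p j → (P · T · longWeyl · Q) p j ≈
                 sum λ l → P p (opposite l) * Δ l * Q l j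
  bruhat-entry P Q p j = sum-cong-≋ λ l → *-congʳ {x = Q l j} (begin
    (P · T · longWeyl) p l               ≈⟨ ·-longWeyl (P · T) p l ⟩
    (P · T) p (opposite l) * sign l      ≈⟨ *-congʳ (·-diagonal P torus p (opposite l)) ⟩
    P p (opposite l) * torus (opposite l) * sign l
                                         ≈⟨ *-assoc _ _ _ ⟩
    P p (opposite l) * Δ l               ∎)

  -- `rightMinor` takes rows counted from the bottom. `leftMinor` is its transpose: the listed
  -- arguments are rows of `g`, again from the bottom, and the coordinates are its columns 0,...,k.
  -- Both depend on `g` alone, not on a factorisation.
  rightMinor leftMinor : Mℤ.Matrix (suc m) → Fin m → Carrier
  rightMinor g k = minor (upTo opposite k) (skipping (λ j p → fromℤ (g p j)) k)
  leftMinor  g k = minor (upTo id k) (skipping (λ j q → fromℤ (g (opposite j) q)) k)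

  minor-Integral : ∀ is {f : Fin (suc m) → Fin (suc m) → ℤ} k →
                   Integral (minor is (skipping (λ j p → fromℤ (f j p)) k))
  minor-Integral is {f} k = minor-closed Integral Integral-0 Integral-1 Integral-* Integral-- is
    (skipping-All (λ j p → f j p , refl) k)

  module _ {g : Mℤ.Matrix (suc m)} {P Q : Matrix (suc m)}
           (P-uni : UpperUnipotent P) (Q-uni : UpperUnipotent Q)
           (g≋ : real g ≋ P · T · longWeyl · Q) where

    -- Reversing both indices makes `P` lower unipotent, and Δ is absorbed into that factor. `P` and
    -- `Q` form an arbitrary factorisation of `g`, so that two factorisations can be compared
    -- through their common minor.
    right-superdiagonal : ∀ k → fromNat (proj₁ (D k)) * Q (inject₁ k) (suc k) ≈
                          productTo sign k * rightMinor g k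
    right-superdiagonal k = unscale k (trans
      (minor-alternating (upTo opposite k) .cong (skipping-Pointwise
        (λ j p → trans (g≋ p j) (bruhat-entry P Q p j)) k))
      (minor-LU opposite (λ l p → P p (opposite l) * Δ l) Δ Q-uni
        (λ {i} {j} i<j → trans (*-congʳ (proj₂ P-uni _ _ (opposite-< i<j))) (zeroˡ (Δ j)))
        (λ i → trans (*-congʳ (proj₁ P-uni (opposite i))) (*-identityˡ (Δ i))) k))

    -- The transposed case: ΔQ transposed is the lower factor, and `P` with both indices reversed
    -- and then transposed is the upper one.
    left-superdiagonal : ∀ k → fromNat (proj₁ (D k)) * P (opposite (suc k)) (opposite (inject₁ k)) ≈
                         productTo sign k * leftMinor g k
    left-superdiagonal k = unscale k (trans
      (minor-alternating (upTo id k) .cong (skipping-Pointwise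
        (λ j q → trans (g≋ (opposite j) q) (trans (bruhat-entry P Q (opposite j) q)
          (sum-cong-≋ λ l → trans (*-assoc (P (opposite j) (opposite l)) (Δ l) (Q l q)) (*-comm _ _)))) k))
      (minor-LU id (λ l q → Δ l * Q l q) Δ {λ l j → P (opposite j) (opposite l)}
        ((λ i → proj₁ P-uni (opposite i)) , λ i j j<i → proj₂ P-uni _ _ (opposite-< j<i))
        (λ {i} {j} i<j → trans (*-congˡ (proj₂ Q-uni _ _ i<j)) (zeroʳ (Δ j)))
        (λ i → trans (*-congˡ (proj₁ Q-uni i)) (*-identityʳ (Δ i))) k))

    -- Put k = `opposite i`. Entry i of the superdiagonal of `P` is thus paired with
    -- `D (opposite i)`, in agreement with `reverse M` in the sum.
    left-superdiagonal′ : ∀ i → fromNat (proj₁ (D (opposite i))) * P (inject₁ i) (suc i) ≈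
                          productTo sign (opposite i) * leftMinor g (opposite i)
    left-superdiagonal′ i = ≡.subst₂
      (λ p q → fromNat (proj₁ (D (opposite i))) * P p q ≈
               productTo sign (opposite i) * leftMinor g (opposite i))
      -- `opposite (suc k)` computes to `inject₁ (opposite k)`; the other index requires
      -- `opposite-inject₁`.
      (≡.cong inject₁ (Fin.opposite-involutive i))
      (≡.trans (opposite-inject₁ (opposite i)) (≡.cong suc (Fin.opposite-involutive i)))
      (left-superdiagonal (opposite i))

-- Integrality on a Bruhat cell and change of representative.

module _ {c ℓ₁ ℓ₂} (R : Reals c ℓ₁ ℓ₂) {m} {D : Vector ℕ⁺ m} where
  open Reals R hiding (+-identityˡ)
  open RealProperties R
  open BruhatProperties R D
  open CommutativeRing ℝ hiding (zero; Carrier; _≈_; _+_; _*_; -_; 0#; 1#; rawRing; isCommutativeRing; _-_)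
  open Matrices rawRing
  open MatrixProperties ℝ
  open BruhatCell

  scaled-b₂-integral : ∀ (x : BruhatCell R D) k →
                       Integral (fromNat (proj₁ (D k)) * b₂ x (inject₁ k) (suc k))
  scaled-b₂-integral x k = ≈-Integral
    (right-superdiagonal {γ x} {b₁ x} {b₂ x} (b₁-unipotent x) (b₂-unipotent x) (decomposition x) k)
    (Integral-* (proj₁ (productTo-sign-unit k)) (minor-Integral (upTo opposite k) {λ j p → γ x p j} k))

  scaled-b₁-integral : ∀ (x : BruhatCell R D) i →
                       Integral (fromNat (proj₁ (D (opposite i))) * b₁ x (inject₁ i) (suc i))
  scaled-b₁-integral x i = ≈-Integral
    (left-superdiagonal′ {γ x} {b₁ x} {b₂ x} (b₁-unipotent x) (b₂-unipotent x) (decomposition x) i)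
    (Integral-* (proj₁ (productTo-sign-unit (opposite i)))
      (minor-Integral (upTo id (opposite i)) {λ j → γ x (opposite j)} (opposite i)))

  module _ {x y : BruhatCell R D} (x~y : SameDoubleCoset R x y) where
    private
      u = proj₁ x~y
      v = proj₁ (proj₂ x~y)
      u-uni = real-unipotent {P = u} (proj₁ (proj₂ (proj₂ x~y)))
      v-uni = real-unipotent {P = v} (proj₁ (proj₂ (proj₂ (proj₂ x~y))))
      γy≋ : γ y Mℤ.≋ u Mℤ.· γ x Mℤ.· v
      γy≋ = proj₂ (proj₂ (proj₂ (proj₂ x~y)))
      P = real u · b₁ x
      Q = b₂ x · real v
      P-uni : UpperUnipotent P
      P-uni = ·-unipotent {P = real u} {b₁ x} u-uni (b₁-unipotent x)
      Q-uni : UpperUnipotent Q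
      Q-uni = ·-unipotent {P = b₂ x} {real v} (b₂-unipotent x) v-uni

      -- Absorbing u into `b₁ x` and v into `b₂ x` gives a second factorisation of `γ y`, besides
      -- its own.
      decomposition′ : real (γ y) ≋ P · T · longWeyl · Q
      decomposition′ =
        ≋-trans (λ i j → reflexive (≡.cong fromℤ (γy≋ i j)))
        (≋-trans (real-· (u Mℤ.· γ x) v)
        (≋-trans (·-congʳ (real v) (≋-trans (real-· u (γ x)) (·-congˡ (real u) (decomposition x))))
        (≋-trans (·-congʳ (real v) (≋-sym (·-assoc (real u) (b₁ x · T · longWeyl) (b₂ x))))
        (≋-trans (·-assoc (real u · (b₁ x · T · longWeyl)) (b₂ x) (real v))
        (·-congʳ Q (≋-trans (≋-sym (·-assoc (real u) (b₁ x · T) longWeyl))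
          (·-congʳ longWeyl (≋-sym (·-assoc (real u) (b₁ x) T)))))))))

    -- Both factorisations of `γ y` express `D k` times the entry by the same signed minor, so after
    -- cancelling `D k` the entries of `b₂ y` and `b₂ x · real v` agree. The latter exceeds that of
    -- `b₂ x` by an integer entry of v.
    b₂-∼ : ∀ k → b₂ y (inject₁ k) (suc k) ∼ b₂ x (inject₁ k) (suc k)
    b₂-∼ k = v (inject₁ k) (suc k) , trans
      (fromNat-cancel (D k) (trans
        (right-superdiagonal {γ y} {b₁ y} {b₂ y} (b₁-unipotent y) (b₂-unipotent y) (decomposition y) k)
        (sym (right-superdiagonal {γ y} {P} {Q} P-uni Q-uni decomposition′ k))))
      (·-superdiagonal {P = b₂ x} {real v} (b₂-unipotent x) v-uni k)

    b₁-∼ : ∀ k → b₁ y (inject₁ k) (suc k) ∼ b₁ x (inject₁ k) (suc k)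
    b₁-∼ k = u (inject₁ k) (suc k) , trans
      (fromNat-cancel (D (opposite k)) (trans
        (left-superdiagonal′ {γ y} {b₁ y} {b₂ y} (b₁-unipotent y) (b₂-unipotent y) (decomposition y) k)
        (sym (left-superdiagonal′ {γ y} {P} {Q} P-uni Q-uni decomposition′ k))))
      (trans (·-superdiagonal {P = real u} {b₁ x} u-uni (b₁-unipotent x) k) (+-comm _ _))

  -- Matching two enumerations of the double cosets.

  SameDoubleCoset-trans : ∀ {x y z : BruhatCell R D} →
                          SameDoubleCoset R x y → SameDoubleCoset R y z → SameDoubleCoset R x z
  SameDoubleCoset-trans {x} {y} {z} (u , v , u-uni , v-uni , γy≋) (u′ , v′ , u′-uni , v′-uni , γz≋) =
    u′ Mℤ.· u , v Mℤ.· v′ , ℤ-Matrix.·-unipotent u′-uni u-uni , ℤ-Matrix.·-unipotent v-uni v′-uni ,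
    ℤ-Matrix.≋-trans γz≋
    (ℤ-Matrix.≋-trans (ℤ-Matrix.·-congʳ v′ (ℤ-Matrix.·-congˡ u′ γy≋))
    (ℤ-Matrix.≋-trans (ℤ-Matrix.·-congʳ v′ (ℤ-Matrix.≋-sym (ℤ-Matrix.·-assoc u′ (u Mℤ.· γ x) v)))
    (ℤ-Matrix.≋-trans (ℤ-Matrix.·-assoc (u′ Mℤ.· (u Mℤ.· γ x)) v v′)
    (ℤ-Matrix.·-congʳ (v Mℤ.· v′) (ℤ-Matrix.≋-sym (ℤ-Matrix.·-assoc u′ u (γ x)))))))

  -- Symmetry of SameDoubleCoset (inverting unipotent matrices) is avoided: both
  -- composites are related to the identity by transitivity alone.
  reindexing : (X X′ : Enumeration R D) →
               let open Enumeration in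
               ∃ λ (π : Permutation (size X′) (size X)) →
                 ∀ k → SameDoubleCoset R (representative X (π ⟨$⟩ʳ k)) (representative X′ k)
  reindexing X X′ = permutation to from to∘from from∘to , to-~
    where
    module X  = Enumeration X
    module X′ = Enumeration X′
    to : Fin X′.size → Fin X.size
    to k = proj₁ (X.representative-sur (X′.representative k))
    to-~ : ∀ k → SameDoubleCoset R (X.representative (to k)) (X′.representative k)
    to-~ k = proj₂ (X.representative-sur (X′.representative k))
    from : Fin X.size → Fin X′.size
    from k = proj₁ (X′.representative-sur (X.representative k))
    from-~ : ∀ k → SameDoubleCoset R (X′.representative (from k)) (X.representative k)
    from-~ k = proj₂ (X′.representative-sur (X.representative k))
    to∘from : ∀ k → to (from k) ≡ k
    to∘from k = X.representative-inj (SameDoubleCoset-trans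
      {X.representative (to (from k))} {X′.representative (from k)} {X.representative k}
      (to-~ (from k)) (from-~ k))
    from∘to : ∀ k → from (to k) ≡ k
    from∘to k = X′.representative-inj (SameDoubleCoset-trans
      {X′.representative (from (to k))} {X.representative (to k)} {X′.representative k}
      (from-~ (to k)) (to-~ k))

-- Periodicity of the exponential and equality of the sums.

open import Data.Integer.Base using (_-_)

module _ {c ℓ₁ ℓ₂} (R : Reals c ℓ₁ ℓ₂) (E : Exponential R) where
  open Reals R hiding (+-identityˡ)
  open RealProperties R
  open CommutativeRing ℝ hiding (zero; Carrier; _≈_; _+_; _*_; -_; 0#; 1#; rawRing; isCommutativeRing; _-_)
  open RingProperties ring
  open Matrices rawRing
  open Exponential E
  private module ℂ = RawRing (complexes R)

  -- Termwise comparison and permutation of a complex sum involve addition alone, which is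
  -- componentwise.
  ℂ-+-commutativeMonoid : CommutativeMonoid c ℓ₁
  ℂ-+-commutativeMonoid = Product.commutativeMonoid +-commutativeMonoid +-commutativeMonoid

  open CommutativeMonoid ℂ-+-commutativeMonoid using () renaming (refl to ℂ-refl; sym to ℂ-sym; trans to ℂ-trans)
  open CommutativeMonoidSum ℂ-+-commutativeMonoid using () renaming (sum-cong-≋ to ℂ-sum-cong; sum-permute to ℂ-sum-permute)

  ℂ-*-cong : ∀ {w x y z} → w ℂ.≈ x → y ℂ.≈ z → w ℂ.* y ℂ.≈ x ℂ.* z
  ℂ-*-cong (w≈x , w≈x′) (y≈z , y≈z′) =
    +-cong (*-cong w≈x y≈z) (-‿cong (*-cong w≈x′ y≈z′)) ,
    +-cong (*-cong w≈x y≈z′) (*-cong w≈x′ y≈z)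

  ℂ-*-identityʳ : ∀ x → x ℂ.* ℂ.1# ℂ.≈ x
  ℂ-*-identityʳ (a , b) =
    trans (+-cong (*-identityʳ a) (trans (-‿cong (zeroʳ b)) -0#≈0#)) (+-identityʳ a) ,
    trans (+-cong (zeroʳ a) (*-identityʳ b)) (+-identityˡ b)

  ℂ-*-identityˡ : ∀ x → ℂ.1# ℂ.* x ℂ.≈ x
  ℂ-*-identityˡ (a , b) =
    trans (+-cong (*-identityˡ a) (trans (-‿cong (zeroˡ b)) -0#≈0#)) (+-identityʳ a) ,
    trans (+-cong (*-identityˡ b) (zeroˡ a)) (+-identityʳ b)

  e-period : ∀ {x y} → e y ℂ.≈ ℂ.1# → e (x + y) ℂ.≈ e x
  e-period {x} {y} ey≈1 = ℂ-trans (e-+ x y) (ℂ-trans (ℂ-*-cong ℂ-refl ey≈1) (ℂ-*-identityʳ (e x)))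

  -- From e(1) = 1: e(0) = e(1) e(0) = e(1 + 0) = 1, which avoids division in ℂ.
  e-0 : e 0# ℂ.≈ ℂ.1#
  e-0 = ℂ-trans (ℂ-sym (ℂ-*-identityˡ (e 0#))) (ℂ-trans (ℂ-*-cong (ℂ-sym e-1) ℂ-refl)
    (ℂ-trans (ℂ-sym (e-+ 1# 0#)) (ℂ-trans (e-cong (+-identityʳ 1#)) e-1)))

  e-fromNat : ∀ k → e (fromNat k) ℂ.≈ ℂ.1#
  e-fromNat zero    = e-0
  e-fromNat (suc k) = ℂ-trans (e-period (e-fromNat k)) e-1

  e-fromℤ : ∀ z → e (fromℤ z) ℂ.≈ ℂ.1#
  e-fromℤ (+ k)    = e-fromNat k
  -- Adding the period k+1 to the negative argument brings it to 0.
  e-fromℤ -[1+ k ] = ℂ-trans (ℂ-sym (e-period (e-fromNat (suc k))))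
    (ℂ-trans (e-cong (-‿inverseˡ (fromNat (suc k)))) e-0)

  e-∼ : ∀ {x y} → x ∼ y → e x ℂ.≈ e y
  e-∼ (z , x≈y+z) = ℂ-trans (e-cong x≈y+z) (e-period (e-fromℤ z))

  -- Coefficients and matrix may both vary, so this serves a change of residues at a fixed matrix as
  -- well as a change of representative at fixed coefficients.
  ψ-∼ : ∀ {m} (M N : Vector ℤ m) (u v : Matrix (suc m)) →
        (∀ i → fromℤ (M i) * u (inject₁ i) (suc i) ∼ fromℤ (N i) * v (inject₁ i) (suc i)) →
        ψ R E M u ℂ.≈ ψ R E N v
  ψ-∼ M N u v M∼N = e-∼ (∼-sum M∼N)

  kloosterman-congruent : ∀ {m} {D : Vector ℕ⁺ m} (X : Enumeration R D) (M M′ N N′ : Vector ℤ m) →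
    (∀ i → + proj₁ (D i) ∣ M i - M′ i) → (∀ i → + proj₁ (D i) ∣ N i - N′ i) →
    kloosterman R E X M N ℂ.≈ kloosterman R E X M′ N′
  kloosterman-congruent X M M′ N N′ M≡M′ N≡N′ = ℂ-sum-cong λ k →
    let x = representative k in ℂ-*-cong
    (ψ-∼ (reverse M) (reverse M′) (b₁ x) (b₁ x) λ i →
      -- `reverse M i` is `M (opposite i)`, and its modulus `D (opposite i)` is the one that clears
      -- entry i of `b₁`.
      ∼-*ʳ {a = reverse M i} {reverse M′ i} (M≡M′ (opposite i)) (scaled-b₁-integral R x i))
    (ψ-∼ N N′ (b₂ x) (b₂ x) λ i →
      ∼-*ʳ {a = N i} {N′ i} (N≡N′ i) (scaled-b₂-integral R x i))
    where open Enumeration X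
          open BruhatCell

  -- The permutation π pairs representatives of the same double coset. Their superdiagonal entries
  -- differ by integers, and integer coefficients preserve this, so the summands agree.
  kloosterman-enumeration : ∀ {m} {D : Vector ℕ⁺ m} (X X′ : Enumeration R D) (M N : Vector ℤ m) →
    kloosterman R E X M N ℂ.≈ kloosterman R E X′ M N
  kloosterman-enumeration {D = D} X X′ M N =
    ℂ-trans (ℂ-sum-permute (term ∘ representative X) π)
            (ℂ-sum-cong λ k → ℂ-sym (term-∼ (representative X (π ⟨$⟩ʳ k)) (representative X′ k)
              (proj₂ (reindexing R X X′) k)))
    where
    open Enumeration
    open BruhatCell
    π = proj₁ (reindexing R X X′)
    term : BruhatCell R D → ℂ.Carrier
    term x = ψ R E (reverse M) (b₁ x) ℂ.* ψ R E N (b₂ x)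
    term-∼ : ∀ x y → SameDoubleCoset R x y → term y ℂ.≈ term x
    term-∼ x y x~y = ℂ-*-cong
      (ψ-∼ (reverse M) (reverse M) (b₁ y) (b₁ x) λ i →
        ∼-*ˡ (M (opposite i)) (b₁-∼ R {x = x} {y} x~y i))
      (ψ-∼ N N (b₂ y) (b₂ x) λ i → ∼-*ˡ (N i) (b₂-∼ R {x = x} {y} x~y i))

proposition3p1 : ∀ {c ℓ₁ ℓ₂} (R : Reals c ℓ₁ ℓ₂) (E : Exponential R)
    (m : ℕ) → 1 ≤ m →
    (D : Vector ℕ⁺ m) (X X′ : Enumeration R D) (M M′ N N′ : Vector ℤ m) →
    (∀ i → + proj₁ (D i) ∣ M i - M′ i) →
    (∀ i → + proj₁ (D i) ∣ N i - N′ i) →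
    RawRing._≈_ (complexes R) (kloosterman R E X M N) (kloosterman R E X′ M′ N′)
proposition3p1 R E m 1≤m D X X′ M M′ N N′ M≡M′ N≡N′ =
  -- The residues change with `X` fixed; then `X` is exchanged for `X′` with the new coefficients
  -- fixed.
  trans (kloosterman-congruent R E X M M′ N N′ M≡M′ N≡N′) (kloosterman-enumeration R E X X′ M′ N′)
  where open CommutativeMonoid (ℂ-+-commutativeMonoid R E) using (trans)
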